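{- Let $\Delta$ be the hereditary class property "bounded maximum degree" and $\Lambda$ the hereditary class property "bounded connected components". Then $\Delta$ is the decomposition horizon of $\Lambda$. Moreover, $\Lambda^\ast=\Lambda^+=\Delta$.
   Context: Graphs are finite and simple. A hereditary class is a class of graphs closed under isomorphism and induced subgraphs. A hereditary class property is a set $\Pi$ of hereditary classes such that $\mathscr C\in\Pi$, $\mathscr D$ hereditary, $\mathscr D\subseteq\mathscr C$ imply $\mathscr D\in\Pi$. $\Delta$ is the set of hereditary classes $\mathscr C$ for which there is $d$ with every graph in $\mathscr C$ having maximum degree at most $d$; $\Lambda$ is the set of hereditary classes $\mathscr C$ for which there is $c$ with every connected component of every graph in $\mathscr C$ having at most $c$ vertices. For non-decreasing $f:\mathbb N\to\mathbb N$ and positive integer $p$, $\mathscr C$ has an $f$-bounded $\Pi$-decomposition with parameter $p$ if there is $\mathscr D_p\in\Pi$ such that every $G\in\mathscr C$ has a partition $V_1,\dots,V_N$ of $V(G)$ with $N\le f(|G|)$ and $G[V_{i_1}\cup\dots\cup V_{i_p}]\in\mathscr D_p$ for all $i_1,\dots,i_p\in[N]$. $\Pi^+$ (resp. $\Pi^\ast$) is the set of hereditary classes that, for every positive integer $p$, have an $f$-bounded $\Pi$-decomposition with parameter $p$ for some constant function $f$ (resp. some non-decreasing $f$ with $f(n)=n^{o(1)}$). $\Pi$ is a decomposition horizon if $\Pi^\ast=\Pi$; the decomposition horizon of $\Lambda$ is the smallest (under inclusion) decomposition horizon containing $\Lambda$. -}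

module Defs where

open import Data.Bool using (Bool; false; T)
open import Data.Fin using (Fin; zero; suc)
open import Data.Fin.Subset using (Subset; inside; outside; _∈_; ∣_∣; ⋃; Nonempty)
open import Data.List using (allFin; map; tabulate)
open import Data.List.Extrema.Nat using (max)
open import Data.Nat using (ℕ; _*_; _^_; _≤_; NonZero)
open import Data.Product using (Σ-syntax; ∃-syntax; _×_; _,_)
open import Data.Vec using ([]; _∷_)
import Data.Vec as Vec
open import Function.Base using (const; _∘_)
open import Function.Bundles using (_↔_; _⇔_; Inverse)
open import Level using (Level; 0ℓ; _⊔_) renaming (suc to lsuc)
open import Relation.Binary.Construct.Closure.ReflexiveTransitive using (Star)
open import Relation.Binary.Core using (Rel)
open import Relation.Binary.Definitions using (Monotonic₁)
open import Relation.Binary.PropositionalEquality using (_≡_)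
open import Relation.Unary using (Pred; _⊆_; _≐_)

private variable
  ℓ ℓ₁ ℓ₂ : Level
  n : ℕ

record Graph : Set where
  field
    order  : ℕ
    adj    : Fin order → Fin order → Bool
    sym    : ∀ u v → adj u v ≡ adj v u
    irrefl : ∀ v → adj v v ≡ false

  Vertex : Set
  Vertex = Fin order

  Adj : Rel Vertex 0ℓ
  Adj u v = T (adj u v)

open Graph public using (order; Vertex; Adj)

record _≅_ (G H : Graph) : Set where
  field
    bijection : Vertex G ↔ Vertex H
  open Inverse bijection public using (to; from)
  field
    preserves-adj : ∀ u v → Graph.adj H (to u) (to v) ≡ Graph.adj G u v

-- The increasing enumeration of the elements of S.
element : (S : Subset n) → Fin ∣ S ∣ → Fin n
element (inside  ∷ S) zero    = zero
element (inside  ∷ S) (suc i) = suc (element S i)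
element (outside ∷ S) i       = suc (element S i)

-- The induced subgraph G[S], with its vertices renumbered in order.
_[_] : (G : Graph) → Subset (order G) → Graph
G [ S ] = record
  { order  = ∣ S ∣
  ; adj    = λ i j → Graph.adj G (element S i) (element S j)
  ; sym    = λ i j → Graph.sym G (element S i) (element S j)
  ; irrefl = λ i → Graph.irrefl G (element S i)
  }

degree : (G : Graph) → Vertex G → ℕ
degree G v = ∣ Vec.tabulate (Graph.adj G v) ∣

-- The graph without vertices gets maximum degree 0.
maxDegree : Graph → ℕ
maxDegree G = max 0 (map (degree G) (allFin (order G)))

-- A connected component is the set of vertices joined by a walk to some
-- fixed vertex.
IsComponent : (G : Graph) → Subset (order G) → Set
IsComponent G S = ∃[ v ] (∀ u → u ∈ S ⇔ Star (Adj G) v u)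

record HereditaryClass : Set₁ where
  field
    Member    : Pred Graph 0ℓ
    resp-≅    : ∀ {G H} → G ≅ H → Member G → Member H
    inducedSG : ∀ G (S : Subset (order G)) → Member G → Member (G [ S ])

open HereditaryClass public using (Member)

_⊑_ : HereditaryClass → HereditaryClass → Set
𝒟 ⊑ 𝒞 = Member 𝒟 ⊆ Member 𝒞

record HereditaryClassProperty (ℓ : Level) : Set (lsuc 0ℓ ⊔ lsuc ℓ) where
  field
    Holds    : Pred HereditaryClass ℓ
    downward : ∀ 𝒞 𝒟 → Holds 𝒞 → 𝒟 ⊑ 𝒞 → Holds 𝒟

open HereditaryClassProperty public using (Holds)

infix 4 _⊆ₚ_ _≐ₚ_

_⊆ₚ_ : HereditaryClassProperty ℓ₁ → HereditaryClassProperty ℓ₂ → Set _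
Π₁ ⊆ₚ Π₂ = Holds Π₁ ⊆ Holds Π₂

_≐ₚ_ : HereditaryClassProperty ℓ₁ → HereditaryClassProperty ℓ₂ → Set _
Π₁ ≐ₚ Π₂ = Holds Π₁ ≐ Holds Π₂

Δ : HereditaryClassProperty 0ℓ
Δ = record
  { Holds    = λ 𝒞 → ∃[ d ] (∀ G → Member 𝒞 G → maxDegree G ≤ d)
  ; downward = λ _ _ (d , bound) 𝒟⊑𝒞 → d , λ G G∈𝒟 → bound G (𝒟⊑𝒞 G∈𝒟)
  }

Λ : HereditaryClassProperty 0ℓ
Λ = record
  { Holds    = λ 𝒞 → ∃[ c ] (∀ G → Member 𝒞 G → ∀ S → IsComponent G S → ∣ S ∣ ≤ c)
  ; downward = λ _ _ (c , bound) 𝒟⊑𝒞 → c , λ G G∈𝒟 → bound G (𝒟⊑𝒞 G∈𝒟)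
  }

record Partition (n N : ℕ) : Set where
  field
    part     : Fin N → Subset n
    nonempty : ∀ i → Nonempty (part i)
    disjoint : ∀ {i j v} → v ∈ part i → v ∈ part j → i ≡ j
    covers   : ∀ v → ∃[ i ] v ∈ part i

open Partition public using (part)

HasDecomposition : (ℕ → ℕ) → HereditaryClassProperty ℓ → ℕ → Pred HereditaryClass (lsuc 0ℓ ⊔ ℓ)
HasDecomposition f Π p 𝒞 =
  Σ[ 𝒟 ∈ HereditaryClass ] Holds Π 𝒟 ×
    (∀ G → Member 𝒞 G →
      ∃[ N ] N ≤ f (order G) ×
        (Σ[ P ∈ Partition (order G) N ]
          (∀ (i : Fin p → Fin N) → Member 𝒟 (G [ ⋃ (tabulate (part P ∘ i)) ]))))

NonDecreasing : (ℕ → ℕ) → Set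
NonDecreasing = Monotonic₁ _≤_ _≤_

-- f(n) = n^{o(1)}: for every rational ε = a/b > 0 and all large n,
-- n^{-ε} ≤ f(n) ≤ n^ε; both inequalities are raised to the power b and
-- cleared of negative exponents.
Subpolynomial : (ℕ → ℕ) → Set
Subpolynomial f =
  ∀ a b .{{_ : NonZero a}} .{{_ : NonZero b}} →
    ∃[ n₀ ] (∀ n → n₀ ≤ n → f n ^ b ≤ n ^ a × 1 ≤ n ^ a * f n ^ b)

decomposition-downward :
  ∀ (f : ℕ → ℕ) (Π : HereditaryClassProperty ℓ) p 𝒞 𝒟 →
  HasDecomposition f Π p 𝒞 → 𝒟 ⊑ 𝒞 → HasDecomposition f Π p 𝒟
decomposition-downward f Π p _ _ (ℰ , ℰ∈Π , dec) 𝒟⊑𝒞 =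
  ℰ , ℰ∈Π , λ G G∈𝒟 → dec G (𝒟⊑𝒞 G∈𝒟)

infix 8 _⁺ _∗

-- In both Π ⁺ and Π ∗ the function f may depend on the parameter p.
_⁺ : HereditaryClassProperty ℓ → HereditaryClassProperty (lsuc 0ℓ ⊔ ℓ)
Π ⁺ = record
  { Holds    = λ 𝒞 → ∀ p .{{_ : NonZero p}} → ∃[ k ] HasDecomposition (const k) Π p 𝒞
  ; downward = λ 𝒞 𝒟 𝒞∈Π⁺ 𝒟⊑𝒞 p →
      let (k , dec) = 𝒞∈Π⁺ p in k , decomposition-downward (const k) Π p 𝒞 𝒟 dec 𝒟⊑𝒞
  }

_∗ : HereditaryClassProperty ℓ → HereditaryClassProperty (lsuc 0ℓ ⊔ ℓ)
Π ∗ = record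
  { Holds    = λ 𝒞 → ∀ p .{{_ : NonZero p}} →
      ∃[ f ] NonDecreasing f × Subpolynomial f × HasDecomposition f Π p 𝒞
  ; downward = λ 𝒞 𝒟 𝒞∈Π∗ 𝒟⊑𝒞 p →
      let (f , mono , sub , dec) = 𝒞∈Π∗ p
      in f , mono , sub , decomposition-downward f Π p 𝒞 𝒟 dec 𝒟⊑𝒞
  }

IsDecompositionHorizon : HereditaryClassProperty ℓ → Set _
IsDecompositionHorizon Π = Π ∗ ≐ₚ Π

-- Π is the smallest decomposition horizon containing Π₀.  The level of the
-- competing properties Π′ is a parameter, since quantifying over it here
-- would leave Set.
record IsDecompositionHorizonOf (ℓ : Level)
         (Π : HereditaryClassProperty ℓ₁) (Π₀ : HereditaryClassProperty ℓ₂)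
         : Set (lsuc 0ℓ ⊔ lsuc ℓ ⊔ ℓ₁ ⊔ ℓ₂) where
  field
    isHorizon : IsDecompositionHorizon Π
    contains  : Π₀ ⊆ₚ Π
    smallest  : ∀ (Π′ : HereditaryClassProperty ℓ) →
                IsDecompositionHorizon Π′ → Π₀ ⊆ₚ Π′ → Π ⊆ₚ Π′

{-# OPTIONS --safe #-}

-- Λ ∗ ⊆ Δ holds because Δ ∗ ⊆ Δ: let H be the subgraph induced by a vertex v
-- and its neighbours.  In a decomposition of H with parameter 2, each part
-- together with the part of v induces a graph of degree at most d in which v
-- is adjacent to everything, so each part has at most 1 + d vertices and
-- |H| ≤ f(|H|) (1 + d), which bounds |H| as f is subpolynomial.
-- Conversely Δ ⊆ Λ ⁺: colour a graph of bounded degree greedily so that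
-- distinct vertices joined by a walk of length at most p get distinct colours.
-- In the union of p colour classes a walk of length p repeats a colour, hence a
-- vertex, and can be shortened; so connected vertices are joined by walks
-- shorter than p, and a component has at most one vertex of each colour.
module Submission where

open import Defs
open import Data.Bool using (Bool; T)
open import Data.Bool.Properties using (T-≡)
open import Data.Fin as Fin using (Fin; zero; suc; punchOut)
open import Data.Fin.Properties as Finₚ using (pigeonhole; injective⇒≤; punchOut-injective; ¬∀⟶∃¬)
open import Data.Fin.Subset using (Subset; inside; outside; _∈_; ∣_∣; ⋃; _∪_; ⁅_⁆; ⊤)
open import Data.Fin.Subset.Properties
  using (∈⊤; ∣⊤∣≡n; ∉⊥; ∣⊥∣≡0; p⊆q⇒∣p∣≤∣q∣; ∣q∣≤∣p∪q∣; x∈p∪q⁺; x∈p∪q⁻; x∈⁅x⁆; x∈⁅y⁆⇒x≡y; ∣⁅x⁆∣≡1; drop-there)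
open import Data.List as List using (List; []; _∷_; length; concatMap; allFin; tabulate)
open import Data.List.Extrema.Nat using (max≤v⁺; xs≤max)
open import Data.List.Membership.Propositional using (lose) renaming (_∈_ to _∈ˡ_)
open import Data.List.Membership.Propositional.Properties
  using (∈-map⁺; ∈-allFin; ∈-concatMap⁺) renaming (∈-tabulate⁺ to ∈ˡ-tabulate⁺)
import Data.List.Membership.DecPropositional as DecMembership
open import Data.List.Membership.Setoid.Properties using (index-injective)
open import Data.List.Properties using (length-map; length-tabulate; length-++)
open import Data.List.Relation.Unary.All as All using ()
import Data.List.Relation.Unary.All.Properties as Allₚ
open import Data.List.Relation.Unary.Any using (here; there)
open import Data.Nat
  using (ℕ; zero; suc; _+_; _*_; _^_; _⊔_; _≤_; _<_; z≤n; s≤s; NonZero; >-nonZero; >-nonZero⁻¹)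
open import Data.Nat.Properties
open import Data.Product using (Σ-syntax; ∃-syntax; _×_; _,_; proj₁; proj₂)
open import Data.Sum using (inj₁; inj₂)
import Data.Vec as Vec
open import Data.Vec.Properties using (lookup∘tabulate; lookup⇒[]=; []=⇒lookup)
open import Function.Base using (const; _∘_; id)
open import Function.Bundles using (Equivalence; Inverse; mk⇔)
open import Level using (Level; 0ℓ)
open import Relation.Binary.Construct.Closure.ReflexiveTransitive using (Star; ε; _◅_; _◅◅_; gmap; reverse)
open import Relation.Binary.Core using (Rel)
open import Relation.Binary.Definitions using (Symmetric)
open import Relation.Binary.PropositionalEquality
  using (_≡_; _≢_; refl; sym; trans; cong; subst; subst₂; setoid)
open import Relation.Nullary using (¬_; yes; no; contradiction)
open import Relation.Nullary.Decidable using (⌊_⌋; toWitness; fromWitness)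

private variable
  ℓ ℓ₁ ℓ₂ : Level
  A : Set
  n N k p : ℕ

-- Finite subsets

∈-tabulate⁺ : (f : Fin n → Bool) {v : Fin n} → T (f v) → v ∈ Vec.tabulate f
∈-tabulate⁺ f {v} t =
  lookup⇒[]= v _ (trans (lookup∘tabulate f v) (Equivalence.to T-≡ t))

∈-tabulate⁻ : (f : Fin n → Bool) {v : Fin n} → v ∈ Vec.tabulate f → T (f v)
∈-tabulate⁻ f {v} v∈ =
  Equivalence.from T-≡ (trans (sym (lookup∘tabulate f v)) ([]=⇒lookup v∈))

∈⋃⁺ : (f : Fin k → Subset n) (i : Fin k) {v : Fin n} → v ∈ f i → v ∈ ⋃ (tabulate f)
∈⋃⁺ f zero    v∈ = x∈p∪q⁺ (inj₁ v∈)
∈⋃⁺ f (suc i) v∈ = x∈p∪q⁺ (inj₂ (∈⋃⁺ (f ∘ suc) i v∈))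

∈⋃⁻ : (f : Fin k → Subset n) {v : Fin n} → v ∈ ⋃ (tabulate f) → ∃[ i ] v ∈ f i
∈⋃⁻ {k = zero}  f v∈ = contradiction v∈ ∉⊥
∈⋃⁻ {k = suc k} f v∈ with x∈p∪q⁻ (f zero) _ v∈
... | inj₁ v∈f₀ = zero , v∈f₀
... | inj₂ v∈⋃ = let (i , v∈fᵢ) = ∈⋃⁻ (f ∘ suc) v∈⋃ in suc i , v∈fᵢ

∣p∪q∣≤∣p∣+∣q∣ : (S U : Subset n) → ∣ S ∪ U ∣ ≤ ∣ S ∣ + ∣ U ∣
∣p∪q∣≤∣p∣+∣q∣ Vec.[]              Vec.[]              = z≤n
∣p∪q∣≤∣p∣+∣q∣ (outside Vec.∷ S) (outside Vec.∷ U) = ∣p∪q∣≤∣p∣+∣q∣ S U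
∣p∪q∣≤∣p∣+∣q∣ (outside Vec.∷ S) (inside  Vec.∷ U) =
  ≤-trans (s≤s (∣p∪q∣≤∣p∣+∣q∣ S U)) (≤-reflexive (sym (+-suc ∣ S ∣ ∣ U ∣)))
∣p∪q∣≤∣p∣+∣q∣ (inside  Vec.∷ S) (outside Vec.∷ U) = s≤s (∣p∪q∣≤∣p∣+∣q∣ S U)
∣p∪q∣≤∣p∣+∣q∣ (inside  Vec.∷ S) (inside  Vec.∷ U) =
  s≤s (≤-trans (∣p∪q∣≤∣p∣+∣q∣ S U) (+-monoʳ-≤ ∣ S ∣ (n≤1+n ∣ U ∣)))

∣⋃∣≤ : ∀ {b} (f : Fin k → Subset n) → (∀ i → ∣ f i ∣ ≤ b) → ∣ ⋃ (tabulate f) ∣ ≤ k * b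
∣⋃∣≤ {k = zero}  {n} f f≤b = ≤-reflexive (∣⊥∣≡0 n)
∣⋃∣≤ {k = suc k}     f f≤b =
  ≤-trans (∣p∪q∣≤∣p∣+∣q∣ (f zero) _) (+-mono-≤ (f≤b zero) (∣⋃∣≤ (f ∘ suc) (f≤b ∘ suc)))

element-∈ : (S : Subset n) (i : Fin ∣ S ∣) → element S i ∈ S
element-∈ (inside  Vec.∷ S) zero    = Vec.here
element-∈ (inside  Vec.∷ S) (suc i) = Vec.there (element-∈ S i)
element-∈ (outside Vec.∷ S) i       = Vec.there (element-∈ S i)

element-injective : (S : Subset n) {i j : Fin ∣ S ∣} → element S i ≡ element S j → i ≡ j
element-injective (inside  Vec.∷ S) {zero}  {zero}  eq = refl
element-injective (inside  Vec.∷ S) {suc i} {suc j} eq =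
  cong suc (element-injective S (Finₚ.suc-injective eq))
element-injective (outside Vec.∷ S) eq = element-injective S (Finₚ.suc-injective eq)

element-surjective : (S : Subset n) {v : Fin n} → v ∈ S → ∃[ i ] element S i ≡ v
element-surjective (inside Vec.∷ S)  {zero}  v∈ = zero , refl
element-surjective (inside Vec.∷ S)  {suc v} v∈ =
  let (i , eq) = element-surjective S (drop-there v∈) in suc i , cong suc eq
element-surjective (outside Vec.∷ S) {suc v} v∈ =
  let (i , eq) = element-surjective S (drop-there v∈) in i , cong suc eq

-- Degrees and dominating vertices

neighbours : (G : Graph) → Vertex G → Subset (order G)
neighbours G v = Vec.tabulate (Graph.adj G v)

closedNeighbourhood : (G : Graph) → Vertex G → Subset (order G)
closedNeighbourhood G v = ⁅ v ⁆ ∪ neighbours G v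

Adj-sym : (G : Graph) → Symmetric (Adj G)
Adj-sym G {u} {v} = subst T (Graph.sym G u v)

degree≤maxDegree : (G : Graph) (v : Vertex G) → degree G v ≤ maxDegree G
degree≤maxDegree G v =
  All.lookup (xs≤max 0 (List.map (degree G) (allFin (order G)))) (∈-map⁺ (degree G) (∈-allFin v))

maxDegree≤ : ∀ {d} (G : Graph) → (∀ v → degree G v ≤ d) → maxDegree G ≤ d
maxDegree≤ G deg≤d = max≤v⁺ {xs = List.map (degree G) (allFin (order G))} z≤n
  (Allₚ.map⁺ (All.tabulate (λ {v} _ → deg≤d v)))

degree≤∣closedNeighbourhood∣ : (G : Graph) (v : Vertex G) → degree G v ≤ ∣ closedNeighbourhood G v ∣
degree≤∣closedNeighbourhood∣ G v = ∣q∣≤∣p∪q∣ ⁅ v ⁆ (neighbours G v)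

Dominating : (G : Graph) → Vertex G → Set
Dominating G v = ∀ u → u ≢ v → Adj G v u

order≤1+degree : (G : Graph) {v : Vertex G} → Dominating G v → order G ≤ suc (degree G v)
order≤1+degree G {v} dom = begin
  order G                            ≡⟨ ∣⊤∣≡n (order G) ⟨
  ∣ ⊤ {order G} ∣                    ≤⟨ p⊆q⇒∣p∣≤∣q∣ {p = ⊤} (λ {u} _ → covered u) ⟩
  ∣ closedNeighbourhood G v ∣        ≤⟨ ∣p∪q∣≤∣p∣+∣q∣ ⁅ v ⁆ (neighbours G v) ⟩
  ∣ ⁅ v ⁆ ∣ + degree G v             ≡⟨ cong (_+ degree G v) (∣⁅x⁆∣≡1 v) ⟩
  suc (degree G v)                   ∎
  where
  open ≤-Reasoning
  covered : ∀ u → u ∈ closedNeighbourhood G v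
  covered u with u Finₚ.≟ v
  ... | yes refl = x∈p∪q⁺ (inj₁ (x∈⁅x⁆ v))
  ... | no  u≢v  = x∈p∪q⁺ (inj₂ (∈-tabulate⁺ (Graph.adj G v) (dom u u≢v)))

-- Reduces bounds on degrees to bounds on orders: a vertex of large degree yields a large dominated
-- graph in the same hereditary class.
closedNeighbourhood-dominated : (G : Graph) (v : Vertex G) →
  ∃[ w ] Dominating (G [ closedNeighbourhood G v ]) w
closedNeighbourhood-dominated G v with element-surjective S {v} (x∈p∪q⁺ (inj₁ (x∈⁅x⁆ v)))
  where S = closedNeighbourhood G v
... | w , w↦v = w , dom
  where
  S = closedNeighbourhood G v
  dom : Dominating (G [ S ]) w
  dom u u≢w with x∈p∪q⁻ ⁅ v ⁆ (neighbours G v) (element-∈ S u)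
  ... | inj₁ u∈⁅v⁆ =
    contradiction (element-injective S (trans (x∈⁅y⁆⇒x≡y v u∈⁅v⁆) (sym w↦v))) u≢w
  ... | inj₂ u∈nbr =
    subst (λ x → Adj G x (element S u)) (sym w↦v) (∈-tabulate⁻ (Graph.adj G v) u∈nbr)

dominating-induced : (G : Graph) {v : Vertex G} → Dominating G v →
  (S : Subset (order G)) → v ∈ S → ∃[ w ] Dominating (G [ S ]) w
dominating-induced G {v} dom S v∈S with element-surjective S v∈S
... | w , refl = w , λ u u≢w → dom (element S u) (u≢w ∘ element-injective S)

-- Inclusions into `Δ`

Λ⊆Δ : Λ ⊆ₚ Δ
Λ⊆Δ {𝒞} (c , comp≤c) = c , λ G G∈𝒞 → maxDegree≤ G (deg≤c G G∈𝒞)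
  where
  deg≤c : ∀ G → Member 𝒞 G → ∀ v → degree G v ≤ c
  -- The dominated graph `H` is connected, so `⊤` is a component of it. Working in `H` avoids
  -- presenting the component of `v` in `G` as a decidable subset.
  deg≤c G G∈𝒞 v with closedNeighbourhood-dominated G v
  ... | w , dom = begin
    degree G v         ≤⟨ degree≤∣closedNeighbourhood∣ G v ⟩
    order H            ≡⟨ ∣⊤∣≡n (order H) ⟨
    ∣ ⊤ {order H} ∣    ≤⟨ comp≤c H (HereditaryClass.inducedSG 𝒞 G _ G∈𝒞) ⊤
                             (w , λ u → mk⇔ (λ _ → walk u) (λ _ → ∈⊤)) ⟩
    c                  ∎
    where
    open ≤-Reasoning
    H = G [ closedNeighbourhood G v ]
    walk : ∀ u → Star (Adj H) w u
    walk u with u Finₚ.≟ w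
    ... | yes refl = ε
    ... | no  u≢w  = dom u u≢w ◅ ε

-- Squaring gives m² ≤ n²e² ≤ me², and m cancels. The exponents 2 and 1 match `Subpolynomial` at ε =
-- 1/2.
m≤n*e∧n²≤m⇒m≤e² : ∀ m n e → m ≤ n * e → n ^ 2 ≤ m ^ 1 → m ≤ e * e
m≤n*e∧n²≤m⇒m≤e² zero      n e _    _    = z≤n
m≤n*e∧n²≤m⇒m≤e² m@(suc _) n e m≤ne n²≤m = *-cancelˡ-≤ m (begin
  m * m              ≤⟨ *-mono-≤ m≤ne m≤ne ⟩
  n * e * (n * e)    ≡⟨ [m*n]*[o*p]≡[m*o]*[n*p] n e n e ⟩
  n * n * (e * e)    ≡⟨ cong (λ x → n * x * (e * e)) (*-identityʳ n) ⟨
  n ^ 2 * (e * e)    ≤⟨ *-monoˡ-≤ (e * e) n²≤m ⟩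
  m ^ 1 * (e * e)    ≡⟨ cong (_* (e * e)) (*-identityʳ m) ⟩
  m * (e * e)        ∎)
  where open ≤-Reasoning

Δ∗⊆Δ : Δ ∗ ⊆ₚ Δ
Δ∗⊆Δ {𝒞} 𝒞∈Δ∗ with 𝒞∈Δ∗ 2
-- Any ε < 1 would do; ε = 1/2 gives f(n)² ≤ n from `n₀` on. Orders below `n₀` are bounded by `n₀`
-- itself, hence the maximum.
... | f , mono , sub , 𝒟 , (d , deg≤d) , dec with sub 1 2
... | n₀ , f²≤ = n₀ ⊔ suc d * suc d , λ G G∈𝒞 → maxDegree≤ G (bound G G∈𝒞)
  where
  pair : Fin N → Fin N → Fin 2 → Fin N
  pair i j zero    = i
  pair i j (suc _) = j

  dominated-order≤ : ∀ H → Member 𝒞 H → ∀ {w} → Dominating H w → order H ≤ f (order H) * suc d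
  dominated-order≤ H H∈𝒞 {w} dom with dec H H∈𝒞
  ... | N , N≤f , P , pairs with Partition.covers P w
  ... | i , w∈i = begin
    order H                        ≡⟨ ∣⊤∣≡n (order H) ⟨
    ∣ ⊤ {order H} ∣                ≤⟨ p⊆q⇒∣p∣≤∣q∣ {p = ⊤} (λ {u} _ → covered u) ⟩
    ∣ ⋃ (tabulate (part P)) ∣      ≤⟨ ∣⋃∣≤ (part P) part≤ ⟩
    N * suc d                      ≤⟨ *-monoˡ-≤ (suc d) N≤f ⟩
    f (order H) * suc d            ∎
    where
    open ≤-Reasoning
    covered : ∀ u → u ∈ ⋃ (tabulate (part P))
    covered u = let (j , u∈j) = Partition.covers P u in ∈⋃⁺ (part P) j u∈j
    part≤ : ∀ j → ∣ part P j ∣ ≤ suc d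
    -- The case `j` = `i` is included, since the indices in a decomposition may repeat.
    part≤ j with dominating-induced H dom (⋃ (tabulate (part P ∘ pair i j))) (∈⋃⁺ (part P ∘ pair i j) zero w∈i)
    ... | x , dom′ = begin
      ∣ part P j ∣          ≤⟨ p⊆q⇒∣p∣≤∣q∣ (∈⋃⁺ (part P ∘ pair i j) (suc zero)) ⟩
      order K               ≤⟨ order≤1+degree K dom′ ⟩
      suc (degree K x)      ≤⟨ s≤s (degree≤maxDegree K x) ⟩
      suc (maxDegree K)     ≤⟨ s≤s (deg≤d K (pairs (pair i j))) ⟩
      suc d                 ∎
      where
      K = H [ ⋃ (tabulate (part P ∘ pair i j)) ]

  bound : ∀ G → Member 𝒞 G → ∀ v → degree G v ≤ n₀ ⊔ suc d * suc d
  bound G G∈𝒞 v with closedNeighbourhood-dominated G v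
  ... | w , dom = ≤-trans (degree≤∣closedNeighbourhood∣ G v) order≤
    where
    -- Decomposing `H` rather than `G` puts `order H` on both sides of the estimate; `f (order G)`
    -- would not bound the degree.
    H = G [ closedNeighbourhood G v ]
    order≤ : order H ≤ n₀ ⊔ suc d * suc d
    order≤ with ≤-total (order H) n₀
    ... | inj₁ small = ≤-trans small (m≤m⊔n n₀ _)
    ... | inj₂ large = ≤-trans
      (m≤n*e∧n²≤m⇒m≤e² (order H) (f (order H)) (suc d)
        (dominated-order≤ H (HereditaryClass.inducedSG 𝒞 G _ G∈𝒞) dom)
        (proj₁ (f²≤ (order H) large)))
      (m≤n⊔m n₀ _)

-- Walks

-- A version of `Star` indexed by length, because the colouring only controls walks of bounded
-- length.
data Walk (R : Rel A 0ℓ) : ℕ → A → A → Set where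
  []  : ∀ {x} → Walk R 0 x x
  _∷_ : ∀ {k x y z} → R x y → Walk R k y z → Walk R (suc k) x z

module _ {R : Rel A 0ℓ} where

  _∷ʳ_ : ∀ {x y z} → Walk R k x y → R y z → Walk R (suc k) x z
  []      ∷ʳ s = s ∷ []
  (r ∷ w) ∷ʳ s = r ∷ (w ∷ʳ s)

  reverseWalk : Symmetric R → ∀ {x y} → Walk R k x y → Walk R k y x
  reverseWalk R-sym []      = []
  reverseWalk R-sym (r ∷ w) = reverseWalk R-sym w ∷ʳ R-sym r

  at : ∀ {x y} → Walk R k x y → Fin (suc k) → A
  at {x = x} w       zero    = x
  at         (_ ∷ w) (suc i) = at w i

  prefix : ∀ {x y} (w : Walk R k x y) (j : Fin (suc k)) → ∃[ l ] l ≤ k × Walk R l x (at w j)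
  prefix w       zero    = 0 , z≤n , []
  prefix (r ∷ w) (suc j) = let (l , l≤k , w′) = prefix w j in suc l , s≤s l≤k , r ∷ w′

  suffix : ∀ {x y} (w : Walk R k x y) (j : Fin (suc k)) → ∃[ l ] l ≤ k × Walk R l (at w j) y
  suffix {k = k} w       zero    = k , ≤-refl , w
  suffix         (r ∷ w) (suc j) = let (l , l≤k , w′) = suffix w j in l , m≤n⇒m≤1+n l≤k , w′

  segment : ∀ {x y} (w : Walk R k x y) {i j : Fin (suc k)} → i Fin.< j →
            ∃[ l ] l ≤ k × Walk R l (at w i) (at w j)
  segment w       {zero}  {j}     _         = prefix w j
  segment (r ∷ w) {suc i} {suc j} (s≤s i<j) =
    let (l , l≤k , w′) = segment w i<j in l , m≤n⇒m≤1+n l≤k , w′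

  -- The closed stretch between the two visits is cut out; it has at least one edge, which makes the
  -- result strictly shorter.
  shortcut : ∀ {x y} (w : Walk R k x y) {i j : Fin (suc k)} → i Fin.< j → at w i ≡ at w j →
             ∃[ l ] l < k × Walk R l x y
  shortcut (r ∷ w) {zero}  {suc j} _         refl =
    let (l , l≤k , w′) = suffix w j in l , s≤s l≤k , w′
  shortcut (r ∷ w) {suc i} {suc j} (s≤s i<j) eq   =
    let (l , l<k , w′) = shortcut w i<j eq in suc l , s≤s l<k , r ∷ w′

mapWalk : ∀ {B : Set} {R : Rel A 0ℓ} {Q : Rel B 0ℓ} (g : A → B) → (∀ {x y} → R x y → Q (g x) (g y)) →
          ∀ {x y} → Walk R k x y → Walk Q k (g x) (g y)
mapWalk g h []      = []
mapWalk g h (r ∷ w) = h r ∷ mapWalk g h w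

-- Colourings that separate vertices joined by short walks

module _ {R : Rel A 0ℓ} (colour : A → Fin p)
         (local : ∀ {k x y} → k ≤ p → Walk R k x y → colour x ≡ colour y → x ≡ y) where

  -- Prepending an edge to a walk shorter than `p` can only fail by reaching length `p`. Its `p` + 1
  -- positions then repeat a colour, and the segment between them is short enough for `local` to
  -- identify its ends.
  shorten : ∀ {x y} → Star R x y → ∃[ k ] k < p × Walk R k x y
  -- The existence of the colour of `x` shows 0 < `p`.
  shorten {x} ε       = 0 , ≤-<-trans z≤n (Finₚ.toℕ<n (colour x)) , []
  shorten     (r ◅ s) with shorten s
  ... | k , k<p , w with m≤n⇒m<n∨m≡n k<p
  ... | inj₁ 1+k<p = suc k , 1+k<p , r ∷ w
  ... | inj₂ refl  =
    let (i , j , i<j , same) = pigeonhole (n<1+n p) (colour ∘ at (r ∷ w))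
        (l , l≤p , w′)       = segment (r ∷ w) i<j
    in shortcut (r ∷ w) i<j (local l≤p w′ same)

  local⇒global : ∀ {x y} → Star R x y → colour x ≡ colour y → x ≡ y
  local⇒global s = let (k , k<p , w) = shorten s in local (<⇒≤ k<p) w

-- Greedy colouring

-- Otherwise, sending each colour to its position would inject K + 1 colours into at most K
-- positions.
fresh : ∀ {K} (cs : List (Fin (suc K))) → length cs ≤ K → ∃[ c ] ¬ (c ∈ˡ cs)
fresh {K} cs ∣cs∣≤K = ¬∀⟶∃¬ (suc K) (_∈ˡ cs) (_∈? cs) λ all∈ →
  <⇒≱ (s≤s ∣cs∣≤K) (injective⇒≤ (λ {i} {j} → index-injective (setoid _) (all∈ i) (all∈ j)))
  where open DecMembership (Finₚ._≟_ {suc K}) using (_∈?_)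

module _ {R : Rel (Fin n) 0ℓ} (R-sym : Symmetric R) {K : ℕ}
         (near : Fin n → List (Fin n)) (∣near∣≤K : ∀ x → length (near x) ≤ K)
         (near-complete : ∀ {x y} → R x y → y ∈ˡ near x) where

  -- Phrased with `x ≡ y` as conclusion because the relation `JoinedWithin`, to which it is applied,
  -- is reflexive.
  ProperOn : List (Fin n) → (Fin n → Fin (suc K)) → Set
  ProperOn vs c = ∀ {x y} → x ∈ˡ vs → y ∈ˡ vs → R x y → c x ≡ c y → x ≡ y

  -- Recolouring `v` avoids all current colours on `near v`. As `near v` may also list vertices
  -- unrelated to `v`, `R` never has to be decided.
  greedyOn : ∀ vs → Σ[ c ∈ (Fin n → Fin (suc K)) ] ProperOn vs c
  greedyOn []       = const zero , λ ()
  greedyOn (v ∷ vs) with greedyOn vs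
  ... | c , proper with fresh (List.map c (near v)) (≤-trans (≤-reflexive (length-map c (near v))) (∣near∣≤K v))
  ... | new , new∉ = c′ , proper′
    where
    c′ : Fin n → Fin (suc K)
    c′ x with x Finₚ.≟ v
    ... | yes _ = new
    ... | no  _ = c x

    new≢ : ∀ {y} → R v y → new ≢ c y
    new≢ Rvy refl = new∉ (∈-map⁺ c (near-complete Rvy))

    tail : ∀ {x} → x ≢ v → x ∈ˡ v ∷ vs → x ∈ˡ vs
    tail x≢v (here x≡v)   = contradiction x≡v x≢v
    tail x≢v (there x∈vs) = x∈vs

    proper′ : ProperOn (v ∷ vs) c′
    proper′ {x} {y} x∈ y∈ Rxy eq with x Finₚ.≟ v | y Finₚ.≟ v
    ... | yes refl | yes refl = refl
    ... | yes refl | no  _    = contradiction eq (new≢ Rxy)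
    ... | no  _    | yes refl = contradiction (sym eq) (new≢ (R-sym Rxy))
    ... | no  x≢v  | no  y≢v  = proper (tail x≢v x∈) (tail y≢v y∈) Rxy eq

  greedy : Σ[ c ∈ (Fin n → Fin (suc K)) ] (∀ {x y} → R x y → c x ≡ c y → x ≡ y)
  greedy = let (c , proper) = greedyOn (allFin n) in c , proper (∈-allFin _) (∈-allFin _)

-- Parts of a partition are non-empty, so unused colours have to be removed.
compress : ∀ K (c : Fin n → Fin K) →
  ∃[ N ] N ≤ K × Σ[ c′ ∈ (Fin n → Fin N) ]
    (∀ i → ∃[ v ] c′ v ≡ i) × (∀ {x y} → c′ x ≡ c′ y → c x ≡ c y)
compress zero    c = 0 , z≤n , c , (λ ()) , id
compress (suc K) c with Finₚ.all? (λ i → Finₚ.any? (λ v → c v Finₚ.≟ i))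
... | yes onto = suc K , ≤-refl , c , onto , id
... | no ¬onto with ¬∀⟶∃¬ (suc K) _ (λ i → Finₚ.any? (λ v → c v Finₚ.≟ i)) ¬onto
... | i , unused with compress K (λ v → punchOut {i = i} {j = c v} (λ i≡cv → unused (v , sym i≡cv)))
... | N , N≤K , c′ , onto , refines =
  N , m≤n⇒m≤1+n N≤K , c′ , onto , λ eq → punchOut-injective {i = i} _ _ (refines eq)

-- Colour classes as a partition

module _ (c : Fin n → Fin N) where

  colourClass : Fin N → Subset n
  colourClass i = Vec.tabulate (λ v → ⌊ c v Finₚ.≟ i ⌋)

  ∈-colourClass⁺ : ∀ {i v} → c v ≡ i → v ∈ colourClass i
  ∈-colourClass⁺ {i} eq = ∈-tabulate⁺ (λ v → ⌊ c v Finₚ.≟ i ⌋) (fromWitness eq)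

  ∈-colourClass⁻ : ∀ {i v} → v ∈ colourClass i → c v ≡ i
  ∈-colourClass⁻ {i} v∈ = toWitness (∈-tabulate⁻ (λ v → ⌊ c v Finₚ.≟ i ⌋) v∈)

  colourPartition : (∀ i → ∃[ v ] c v ≡ i) → Partition n N
  colourPartition onto = record
    { part     = colourClass
    ; nonempty = λ i → let (v , eq) = onto i in v , ∈-colourClass⁺ eq
    ; disjoint = λ v∈i v∈j → trans (sym (∈-colourClass⁻ v∈i)) (∈-colourClass⁻ v∈j)
    ; covers   = λ v → c v , ∈-colourClass⁺ refl
    }

-- Balls in graphs of bounded degree

length-concatMap≤ : ∀ {B : Set} {b} (g : A → List B) → (∀ x → length (g x) ≤ b) →
                    ∀ xs → length (concatMap g xs) ≤ length xs * b
length-concatMap≤ g g≤b []       = z≤n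
length-concatMap≤ g g≤b (x ∷ xs) =
  ≤-trans (≤-reflexive (length-++ (g x))) (+-mono-≤ (g≤b x) (length-concatMap≤ g g≤b xs))

-- The geometric sum 1 + d + ... + d^p.
ballSize : ℕ → ℕ → ℕ
ballSize d zero    = 1
ballSize d (suc p) = suc (d * ballSize d p)

module _ (G : Graph) where

  neighbourList : Vertex G → List (Vertex G)
  neighbourList v = tabulate (element (neighbours G v))

  Adj⇒∈neighbourList : ∀ {u v} → Adj G u v → v ∈ˡ neighbourList u
  Adj⇒∈neighbourList {u} {v} uv with element-surjective (neighbours G u) (∈-tabulate⁺ (Graph.adj G u) uv)
  ... | i , refl = ∈ˡ-tabulate⁺ i

  -- Vertices may be listed repeatedly; the greedy colouring uses only completeness and the length
  -- bound.
  ball : ℕ → Vertex G → List (Vertex G)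
  ball zero    x = x ∷ []
  ball (suc p) x = x ∷ concatMap (ball p) (neighbourList x)

  Walk⇒∈ball : ∀ {x y} → k ≤ p → Walk (Adj G) k x y → y ∈ˡ ball p x
  Walk⇒∈ball {p = zero}  _         []      = here refl
  Walk⇒∈ball {p = suc p} _         []      = here refl
  Walk⇒∈ball {p = suc p} (s≤s k≤p) (r ∷ w) =
    there (∈-concatMap⁺ (ball p) (lose (Adj⇒∈neighbourList r) (Walk⇒∈ball k≤p w)))

  length-ball≤ : ∀ {d} → (∀ v → degree G v ≤ d) → ∀ p x → length (ball p x) ≤ ballSize d p
  length-ball≤         deg≤d zero    x = ≤-refl
  length-ball≤ {d = d} deg≤d (suc p) x = s≤s (≤-trans
    (length-concatMap≤ (ball p) (length-ball≤ deg≤d p) (neighbourList x))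
    (*-monoˡ-≤ (ballSize d p) (≤-trans (≤-reflexive (length-tabulate (element (neighbours G x)))) (deg≤d x))))

  JoinedWithin : ℕ → Rel (Vertex G) 0ℓ
  JoinedWithin p x y = ∃[ k ] k ≤ p × Walk (Adj G) k x y

  JoinedWithin-sym : Symmetric (JoinedWithin p)
  JoinedWithin-sym (k , k≤p , w) = k , k≤p , reverseWalk (Adj-sym G) w

-- Bounding component sizes directly would make closure under induced subgraphs
-- depend on deciding reachability, since components are decidable subsets.
componentwiseColourable : ℕ → HereditaryClass
componentwiseColourable p = record
  { Member    = λ G → Σ[ c ∈ (Vertex G → Fin p) ] (∀ {x y} → Star (Adj G) x y → c x ≡ c y → x ≡ y)
  ; resp-≅    = resp
  ; inducedSG = λ G S (c , inj) →
      c ∘ element S , λ s eq → element-injective S (inj (gmap (element S) id s) eq)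
  }
  where
  resp : ∀ {G H} → G ≅ H → Σ[ c ∈ (Vertex G → Fin p) ] (∀ {x y} → Star (Adj G) x y → c x ≡ c y → x ≡ y)
                         → Σ[ c ∈ (Vertex H → Fin p) ] (∀ {x y} → Star (Adj H) x y → c x ≡ c y → x ≡ y)
  resp {G} {H} iso (c , inj) = c ∘ from , λ {x} {y} s eq →
    trans (sym (to∘from x)) (trans (cong to (inj (gmap from from-adj s) eq)) (to∘from y))
    where
    open _≅_ iso using (bijection; to; from; preserves-adj)
    to∘from : ∀ x → to (from x) ≡ x
    to∘from = Inverse.strictlyInverseˡ bijection
    from-adj : ∀ {x y} → Adj H x y → Adj G (from x) (from y)
    from-adj {x} {y} xy = subst T (preserves-adj (from x) (from y))
      (subst₂ (Adj H) (sym (to∘from x)) (sym (to∘from y)) xy)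

-- Any two vertices of a component are joined through its base vertex, so the colouring embeds the
-- component into `Fin p`.
componentwiseColourable∈Λ : ∀ p → Holds Λ (componentwiseColourable p)
componentwiseColourable∈Λ p = p , bound
  where
  bound : ∀ G → Member (componentwiseColourable p) G → ∀ S → IsComponent G S → ∣ S ∣ ≤ p
  bound G (c , inj) S (v , comp) = injective⇒≤ {f = c ∘ element S} λ {i} {j} eq →
    element-injective S (inj (reverse (Adj-sym G) (reach i) ◅◅ reach j) eq)
    where
    reach : ∀ i → Star (Adj G) v (element S i)
    reach i = Equivalence.to (comp (element S i)) (element-∈ S i)

-- Decomposing graphs of bounded degree

Δ⊆Λ⁺ : Δ ⊆ₚ Λ ⁺
Δ⊆Λ⁺ {𝒞} (d , deg≤d) p =
  -- One colour more than the bound on the balls of radius `p`; this depends on `d` and `p` only.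
  suc (ballSize d p) , componentwiseColourable p , componentwiseColourable∈Λ p , decompose
  where
  decompose : ∀ G → Member 𝒞 G → ∃[ N ] N ≤ suc (ballSize d p) ×
    (Σ[ P ∈ Partition (order G) N ]
      (∀ (i : Fin p → Fin N) → Member (componentwiseColourable p) (G [ ⋃ (tabulate (part P ∘ i)) ])))
  decompose G G∈𝒞
    with greedy (JoinedWithin-sym G {p}) (ball G p)
           (length-ball≤ G (λ v → ≤-trans (degree≤maxDegree G v) (deg≤d G G∈𝒞)) p)
           (λ (k , k≤p , w) → Walk⇒∈ball G k≤p w)
  ... | c₀ , proper with compress (suc (ballSize d p)) c₀
  ... | N , N≤ , c , onto , refines = N , N≤ , colourPartition c onto , member
    where
    member : ∀ (i : Fin p → Fin N) →
             Member (componentwiseColourable p) (G [ ⋃ (tabulate (colourClass c ∘ i)) ])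
    -- Each vertex is coloured by the position in `i` of a class containing it. Equal positions give
    -- equal colours under `c`, hence under `c₀`, which separates the ends of short walks in `G`.
    member i = index , local⇒global index λ {_} {x} {y} k≤p w eq →
      element-injective S (proper (_ , k≤p , mapWalk (element S) id w)
        (refines (trans (has-colour x) (trans (cong i eq) (sym (has-colour y))))))
      where
      S = ⋃ (tabulate (colourClass c ∘ i))
      index : Fin ∣ S ∣ → Fin p
      index x = proj₁ (∈⋃⁻ (colourClass c ∘ i) (element-∈ S x))
      has-colour : ∀ x → c (element S x) ≡ i (index x)
      has-colour x = ∈-colourClass⁻ c (proj₂ (∈⋃⁻ (colourClass c ∘ i) (element-∈ S x)))

-- Properties of the operators ⁺ and ∗

-- From n₀ = k^b on, k^b ≤ n ≤ n^a because a ≥ 1.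
const-subpolynomial : ∀ k .{{_ : NonZero k}} → Subpolynomial (const k)
const-subpolynomial k a b = k ^ b , λ n k^b≤n →
  let instance
        k^b≢0 : NonZero (k ^ b)
        k^b≢0 = m^n≢0 k b
        n≢0 : NonZero n
        n≢0 = >-nonZero (≤-trans (>-nonZero⁻¹ (k ^ b)) k^b≤n)
  in ≤-trans k^b≤n (≤-trans (≤-reflexive (sym (*-identityʳ n))) (^-monoʳ-≤ n (>-nonZero⁻¹ a)))
   , *-mono-≤ (m^n>0 n a) (m^n>0 k b)

-- const 0 is not subpolynomial, as it is not bounded below by n^{-ε}.
⁺⊆∗ : (Π : HereditaryClassProperty ℓ) → Π ⁺ ⊆ₚ Π ∗
⁺⊆∗ Π 𝒞∈Π⁺ p with 𝒞∈Π⁺ p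
... | k , 𝒟 , 𝒟∈Π , dec =
  const (suc k) , (λ _ → ≤-refl) , const-subpolynomial (suc k) ,
  𝒟 , 𝒟∈Π , λ G G∈𝒞 → let (N , N≤k , rest) = dec G G∈𝒞 in N , m≤n⇒m≤1+n N≤k , rest

∗-mono : (Π₁ : HereditaryClassProperty ℓ₁) (Π₂ : HereditaryClassProperty ℓ₂) →
         Π₁ ⊆ₚ Π₂ → Π₁ ∗ ⊆ₚ Π₂ ∗
∗-mono Π₁ Π₂ Π₁⊆Π₂ 𝒞∈ p with 𝒞∈ p
... | f , mono , sub , 𝒟 , 𝒟∈Π₁ , dec = f , mono , sub , 𝒟 , Π₁⊆Π₂ 𝒟∈Π₁ , dec

-- Combining the inclusions

Λ∗⊆Δ : Λ ∗ ⊆ₚ Δ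
Λ∗⊆Δ {𝒞} 𝒞∈Λ∗ = Δ∗⊆Δ {𝒞} (∗-mono Λ Δ (λ {𝒟} → Λ⊆Δ {𝒟}) {𝒞} 𝒞∈Λ∗)

Δ⊆Λ∗ : Δ ⊆ₚ Λ ∗
Δ⊆Λ∗ {𝒞} 𝒞∈Δ = ⁺⊆∗ Λ {𝒞} (Δ⊆Λ⁺ {𝒞} 𝒞∈Δ)

mainTheorem3 : ∀ (ℓ : Level) → IsDecompositionHorizonOf ℓ Δ Λ × (Λ ∗ ≐ₚ Λ ⁺) × (Λ ⁺ ≐ₚ Δ)
mainTheorem3 ℓ =
  record
    { isHorizon = (λ {𝒞} → Δ∗⊆Δ {𝒞})
                -- Δ ⊆ Λ∗ ⊆ Δ∗, so the decomposition into bounded components serves here too.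
                , (λ {𝒞} 𝒞∈Δ → ∗-mono Λ Δ (λ {𝒟} → Λ⊆Δ {𝒟}) {𝒞} (Δ⊆Λ∗ {𝒞} 𝒞∈Δ))
    ; contains  = λ {𝒞} → Λ⊆Δ {𝒞}
    -- The chain is Δ ⊆ Λ∗ ⊆ Π∗ ⊆ Π.
    ; smallest  = λ Π (Π∗⊆Π , _) Λ⊆Π {𝒞} 𝒞∈Δ →
        Π∗⊆Π {𝒞} (∗-mono Λ Π (λ {𝒟} → Λ⊆Π {𝒟}) {𝒞} (Δ⊆Λ∗ {𝒞} 𝒞∈Δ))
    } ,
  ( (λ {𝒞} 𝒞∈Λ∗ → Δ⊆Λ⁺ {𝒞} (Λ∗⊆Δ {𝒞} 𝒞∈Λ∗)) , (λ {𝒞} → ⁺⊆∗ Λ {𝒞}) ) ,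
  ( (λ {𝒞} 𝒞∈Λ⁺ → Λ∗⊆Δ {𝒞} (⁺⊆∗ Λ {𝒞} 𝒞∈Λ⁺)) , (λ {𝒞} → Δ⊆Λ⁺ {𝒞}) )
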